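{- There is an algorithm which, for every instance $\mathcal{I}$ of the restricted assignment problem with feasibility parameter $\varphi(\mathcal{I})$, yields a schedule of makespan at most $$p_{max}+\frac{L_{opt}}{\varphi(\mathcal{I})}=p_{max}+\frac{\sum_{j\in\mathcal{J}}p_j}{m\cdot\varphi(\mathcal{I})},$$ in time $O(m^2n)$.
   Context: An instance $\mathcal{I}$ of the restricted assignment problem consists of a set $\mathcal{M}$ of $m$ machines, a set $\mathcal{J}$ of $n$ jobs, and processing times $p_{ij}\in\{p_j,\infty\}$ for each $j\in\mathcal{J}$, $i\in\mathcal{M}$, where $p_j$ is a non-negative integer. Each job has finite processing time on at least one machine. A schedule (feasible assignment) is a map $\sigma:\mathcal{J}\to\mathcal{M}$ with $p_{\sigma(j)j}<\infty$ for all $j$. The load of machine $i$ is $\sum_{j:\sigma(j)=i}p_j$, and the makespan is the maximum load over all machines. $p_{max}=\max_{j\in\mathcal{J}}p_j$. The feasibility parameter is $\varphi(\mathcal{I})=\frac{\min_{j\in\mathcal{J}}|\{i\in\mathcal{M}:p_{ij}<\infty\}|}{m}$. $L_{opt}$ is the minimum, over feasible assignments of minimum makespan, of the average machine load; every feasible assignment has average machine load $\frac1m\sum_{j\in\mathcal{J}}p_j$, so $L_{opt}=\frac1m\sum_{j\in\mathcal{J}}p_j$. -}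

module Defs where

open import Data.Bool.Base using (if_then_else_)
open import Data.Fin.Base using (Fin; toℕ; fromℕ<; remQuot; finToFun)
import Data.Fin.Properties as Fin
open import Data.Integer.Base using (+_)
open import Data.List.Base using (List; head; drop; map; filter; length; allFin)
open import Data.Nat.ListAction using (sum)
open import Data.List.Extrema.Nat using (min; max; argmin; v<min⁺)
import Data.List.Extrema as Extrema
open import Data.List.Membership.Propositional using (_∈_)
open import Data.List.Membership.Propositional.Properties using (∈-allFin; ∈-filter⁺; ∈-length)
open import Data.List.Relation.Unary.All using (universal)
open import Data.List.Relation.Unary.All.Properties using (map⁺)
open import Data.Maybe.Base using (Maybe; just; nothing)
open import Data.Nat.Base as ℕ using (ℕ; suc; _+_; _*_; _∸_; _^_)
import Data.Nat.Properties as ℕ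
open import Data.Product.Base using (∃; proj₁; proj₂; _,_)
open import Data.Rational.Base as ℚ using (ℚ; _/_)
import Data.Rational.Properties as ℚ
open import Data.Sum.Base using (_⊎_)
open import Function.Base using (_∘_)
open import Relation.Binary.Bundles using (DecTotalOrder)
open import Relation.Binary.Construct.Add.Supremum.Strict ℕ._<_ using (_<⁺_; <⁺-dec)
open import Relation.Binary.PropositionalEquality using (_≡_)
open import Relation.Nullary.Construct.Add.Supremum using (_⁺; [_]; ⊤⁺)
open import Relation.Nullary.Decidable.Core using (Dec; yes; no; does)

ℕ∞ : Set
ℕ∞ = ℕ ⁺

ℕ⇒ℚ : ℕ → ℚ
ℕ⇒ℚ k = + k / 1

record Instance (m n : ℕ) : Set where
  field
    p          : Fin n → ℕ
    ptime      : Fin m → Fin n → ℕ∞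
    restricted : ∀ i j → (ptime i j ≡ [ p j ]) ⊎ (ptime i j ≡ ⊤⁺)
    coverage   : ∀ j → ∃ λ i → ptime i j <⁺ ⊤⁺

Assignment : ℕ → ℕ → Set
Assignment m n = Fin n → Fin m

module _ {m n : ℕ} (I : Instance m n) where
  open Instance I

  finite? : ∀ i j → Dec (ptime i j <⁺ ⊤⁺)
  finite? i j = <⁺-dec ℕ._<?_ (ptime i j) ⊤⁺

  Feasible : Assignment m n → Set
  Feasible σ = ∀ j → ptime (σ j) j <⁺ ⊤⁺

  feasible? : ∀ σ → Dec (Feasible σ)
  feasible? σ = Fin.all? (λ j → finite? (σ j) j)

  load : Assignment m n → Fin m → ℕ
  load σ i = sum (map p (filter (λ j → σ j Fin.≟ i) (allFin n)))

  makespan : Assignment m n → ℕ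
  makespan σ = max 0 (map (load σ) (allFin m))

  totalTime : ℕ
  totalTime = sum (map p (allFin n))

  pmax : ℕ
  pmax = max 0 (map p (allFin n))

  machinesFor : Fin n → ℕ
  machinesFor j = length (filter (λ i → finite? i j) (allFin m))

  -- The seed m is an upper bound of every entry, so for n ≥ 1 this is
  -- the minimum over the jobs.
  minMachines : ℕ
  minMachines = min m (map machinesFor (allFin n))

  feasibleAssignments : List (Assignment m n)
  feasibleAssignments = filter feasible? (map finToFun (allFin (m ^ n)))

  -- The seed of argmin is itself a feasible assignment.
  someOptimal : Assignment m n
  someOptimal = argmin makespan (proj₁ ∘ coverage) feasibleAssignments

  optimalAssignments : List (Assignment m n)
  optimalAssignments =
    filter (λ σ → makespan σ ℕ.≟ makespan someOptimal) feasibleAssignments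

  module _ .{{m≢0 : ℕ.NonZero m}} where

    φ : ℚ
    φ = + minMachines / m

    averageLoad : Assignment m n → ℚ
    averageLoad σ = + sum (map (load σ) (allFin m)) / m

    -- Minimum of the average load over the optimal assignments; the seed
    -- is one of the competing values.
    Lopt : ℚ
    Lopt = Extrema.min (DecTotalOrder.totalOrder ℚ.≤-decTotalOrder)
             (averageLoad someOptimal) (map averageLoad optimalAssignments)

    minMachines>0 : 0 ℕ.< minMachines
    minMachines>0 = v<min⁺ (ℕ.>-nonZero⁻¹ m)
      (map⁺ (universal machinesFor>0 (allFin n)))
      where
      machinesFor>0 : ∀ j → 0 ℕ.< machinesFor j
      machinesFor>0 j = ∈-length (∈-filter⁺ (λ i → finite? i j)
        (∈-allFin (proj₁ (coverage j))) (proj₂ (coverage j)))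

    φ-positive : ℚ.Positive φ
    φ-positive = ℚ.normalize-pos minMachines m {{m≢0}} {{ℕ.>-nonZero minMachines>0}}

    φ-nonZero : ℚ.NonZero φ
    φ-nonZero = ℚ.pos⇒nonZero φ {{φ-positive}}

    mφ-nonZero : ℚ.NonZero (ℕ⇒ℚ m ℚ.* φ)
    mφ-nonZero = ℚ.pos⇒nonZero (ℕ⇒ℚ m ℚ.* φ)
      {{ℚ.pos*pos⇒pos (ℕ⇒ℚ m) {{ℚ.normalize-pos m 1}} φ {{φ-positive}}}}

-- Random access machine with unit cost per instruction.  Registers and
-- memory cells hold natural numbers; the only arithmetic is addition and
-- truncated subtraction.

data Instr : Set where
  set   : (r k : ℕ) → Instr     -- R[r] := k
  copy  : (r s : ℕ) → Instr     -- R[r] := R[s]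
  add   : (r s t : ℕ) → Instr   -- R[r] := R[s] + R[t]
  sub   : (r s t : ℕ) → Instr   -- R[r] := R[s] ∸ R[t]
  read  : (r s : ℕ) → Instr     -- R[r] := M[R[s]]
  write : (r s : ℕ) → Instr     -- M[R[r]] := R[s]
  jump  : (l : ℕ) → Instr
  jzero : (r l : ℕ) → Instr     -- jump to l if R[r] = 0

Program : Set
Program = List Instr

record State : Set where
  constructor ⟨_,_,_⟩
  field
    pc  : ℕ
    reg : ℕ → ℕ
    mem : ℕ → ℕ

open State public

_[_≔_] : (ℕ → ℕ) → ℕ → ℕ → (ℕ → ℕ)
(f [ a ≔ v ]) x = if does (x ℕ.≟ a) then v else f x

exec : Instr → State → State
exec (set r k)   ⟨ c , R , M ⟩ = ⟨ suc c , R [ r ≔ k ] , M ⟩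
exec (copy r s)  ⟨ c , R , M ⟩ = ⟨ suc c , R [ r ≔ R s ] , M ⟩
exec (add r s t) ⟨ c , R , M ⟩ = ⟨ suc c , R [ r ≔ R s + R t ] , M ⟩
exec (sub r s t) ⟨ c , R , M ⟩ = ⟨ suc c , R [ r ≔ R s ∸ R t ] , M ⟩
exec (read r s)  ⟨ c , R , M ⟩ = ⟨ suc c , R [ r ≔ M (R s) ] , M ⟩
exec (write r s) ⟨ c , R , M ⟩ = ⟨ suc c , R , M [ R r ≔ R s ] ⟩
exec (jump l)    ⟨ c , R , M ⟩ = ⟨ l , R , M ⟩
exec (jzero r l) ⟨ c , R , M ⟩ =
  ⟨ (if does (R r ℕ.≟ 0) then l else suc c) , R , M ⟩

-- Undefined exactly when the program counter is outside the program; this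
-- is how a program halts.
fetch : Program → ℕ → Maybe Instr
fetch P c = head (drop c P)

-- P ⊢ s ⇓[ t ] s′ : started in s, P halts in s′ after exactly t steps.
infix 4 _⊢_⇓[_]_

data _⊢_⇓[_]_ (P : Program) : State → ℕ → State → Set where
  halt : ∀ {s} → fetch P (pc s) ≡ nothing → P ⊢ s ⇓[ 0 ] s
  next : ∀ {s t s′ ins} → fetch P (pc s) ≡ just ins →
         P ⊢ exec ins s ⇓[ t ] s′ → P ⊢ s ⇓[ suc t ] s′

encode∞ : ℕ∞ → ℕ
encode∞ ⊤⁺    = 0
encode∞ [ k ] = suc k

-- The processing times are stored job by job: cell j * m + i holds the
-- code of ptime i j, and the cells from n * m on hold 0.
inputMemory : ∀ {m n} → Instance m n → ℕ → ℕ
inputMemory {m} {n} I a with a ℕ.<? n * m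
... | no  _ = 0
... | yes a<nm = let (j , i) = remQuot {n} m (fromℕ< a<nm)
                 in encode∞ (Instance.ptime I i j)

initial : ∀ {m n} → Instance m n → State
initial {m} {n} I = ⟨ 0 , ((λ _ → 0) [ 0 ≔ m ]) [ 1 ≔ n ] , inputMemory I ⟩

-- Register 0 points to an array of length n holding the machine numbers.
Outputs : ∀ {m n} → State → Assignment m n → Set
Outputs s σ = ∀ j → mem s (reg s 0 + toℕ j) ≡ toℕ (σ j)

{-# OPTIONS --safe #-}

-- List scheduling: give each job in turn to the least loaded machine that can run it.
-- When job j goes to machine b, at least minMachines machines can run j and each of them is
-- at least as loaded as b, so minMachines * load b ≤ totalTime before j is added, and
-- minMachines * load b ≤ minMachines * pmax + totalTime afterwards.  Dividing by
-- minMachines = m φ gives the bound, since every assignment has average load totalTime / m.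
-- The scan over the machines costs O(m) per job, hence O(m n) steps in total.

module Submission where

open import Defs
open import Data.Nat.Base using (ℕ; NonZero; _*_; _≤_)
open import Data.Product.Base using (∃-syntax; _×_)
open import Data.Rational.Base as ℚ using (_÷_)
open import Relation.Binary.PropositionalEquality using (_≡_)

open import Data.Bool.Base using (true; false; if_then_else_)
open import Data.Fin.Base using (Fin; zero; suc; toℕ; fromℕ<; combine; remQuot)
import Data.Fin.Properties as Fin
open import Data.Integer.Base as ℤ using (+_)
import Data.Integer.Properties as ℤ
open import Data.List.Base
  using (List; []; _∷_; [_]; _∷ʳ_; _++_; map; filter; length; allFin; tabulate; take)
open import Data.List.Extrema.Nat using (argmax-all; min≤xs; xs≤max)
import Data.List.Extrema as Extrema
open import Data.List.Membership.Propositional.Properties using (∈-allFin; ∈-map⁺)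
open import Data.List.Properties using (map-tabulate; map-++; take-suc-tabulate; take-all; length-tabulate)
open import Data.List.Relation.Unary.All as All using (All; []; _∷_)
import Data.List.Relation.Unary.All.Properties as All
open import Data.Maybe.Base using (just; nothing)
open import Data.Nat.Base as ℕ using (zero; suc; z≤n; s≤s; _+_; _∸_; _<_)
open import Data.Nat.ListAction using (sum)
open import Data.Nat.ListAction.Properties using (sum-++)
import Data.Nat.Properties as ℕ
open import Data.Nat.Tactic.RingSolver using (solve-∀)
open import Data.Product.Base using (_,_; proj₁; proj₂)
open import Data.Rational.Base using (ℚ; _/_)
import Data.Rational.Properties as ℚ
open import Data.Rational.Unnormalised.Base as ℚᵘ using (mkℚᵘ; *≡*; *≤*)
import Data.Rational.Unnormalised.Properties as ℚᵘ
open import Data.Sum.Base using (_⊎_; inj₁; inj₂)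
open import Function.Base using (_∘_; id)
open import Relation.Binary.Bundles using (DecTotalOrder)
open import Relation.Binary.Construct.Add.Supremum.Strict ℕ._<_ using (_<⁺_; [_]<⊤⁺)
open import Relation.Binary.PropositionalEquality
  using (_≢_; refl; sym; trans; cong; cong₂; subst; module ≡-Reasoning)
open import Relation.Nullary using (¬_; Dec; yes; no; does; contradiction)
open import Relation.Nullary.Construct.Add.Supremum using (⊤⁺)
open import Relation.Nullary.Decidable using (dec-true; dec-false)
open import Relation.Unary using (Pred; Decidable)

-- Memory updates, sums over lists, and indices in `Fin`

updated : ∀ (f : ℕ → ℕ) a v → (f [ a ≔ v ]) a ≡ v
updated f a v rewrite dec-true (a ℕ.≟ a) refl = refl

not-updated : ∀ (f : ℕ → ℕ) {a x} v → x ≢ a → (f [ a ≔ v ]) x ≡ f x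
not-updated f {a} {x} v x≢a rewrite dec-false (x ℕ.≟ a) x≢a = refl

module _ {a} {A : Set a} where

  sum-map-+ : ∀ (f g : A → ℕ) xs →
    sum (map (λ x → f x + g x) xs) ≡ sum (map f xs) + sum (map g xs)
  sum-map-+ f g [] = refl
  sum-map-+ f g (x ∷ xs) rewrite sum-map-+ f g xs =
    interchange (f x) (g x) (sum (map f xs)) (sum (map g xs))
    where
    interchange : ∀ a b c d → a + b + (c + d) ≡ a + c + (b + d)
    interchange = solve-∀

  sum-map-0 : ∀ (xs : List A) → sum (map (λ _ → 0) xs) ≡ 0
  sum-map-0 [] = refl
  sum-map-0 (x ∷ xs) = sum-map-0 xs

  sum-map-cong : ∀ {f g : A → ℕ} xs → (∀ x → f x ≡ g x) → sum (map f xs) ≡ sum (map g xs)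
  sum-map-cong [] f≗g = refl
  sum-map-cong (x ∷ xs) f≗g = cong₂ _+_ (f≗g x) (sum-map-cong xs f≗g)

  length-filter*≤sum : ∀ {ℓ} {P : Pred A ℓ} (P? : Decidable P) (f : A → ℕ) c →
    (∀ x → P x → c ≤ f x) → ∀ xs → length (filter P? xs) * c ≤ sum (map f xs)
  length-filter*≤sum P? f c c≤f [] = z≤n
  length-filter*≤sum P? f c c≤f (x ∷ xs) with P? x
  ... | yes Px = ℕ.+-mono-≤ (c≤f x Px) (length-filter*≤sum P? f c c≤f xs)
  ... | no _ = ℕ.m≤n⇒m≤o+n (f x) (length-filter*≤sum P? f c c≤f xs)

  All-take-tabulate : ∀ {ℓ n} {P : Pred A ℓ} {f : Fin n → A} k →
    (∀ i → toℕ i < k → P (f i)) → All P (take k (tabulate f))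
  All-take-tabulate zero Pf = []
  All-take-tabulate {n = zero} (suc k) Pf = []
  All-take-tabulate {n = suc n} (suc k) Pf =
    Pf zero (s≤s z≤n) ∷ All-take-tabulate k (λ i i<k → Pf (suc i) (s≤s i<k))

sum-indicator : ∀ {m} (k : Fin m) v →
  sum (map (λ i → if does (k Fin.≟ i) then v else 0) (allFin m)) ≡ v
sum-indicator {m} k v =
  trans (cong sum (map-tabulate id (λ i → if does (k Fin.≟ i) then v else 0))) (go k)
  where
  constant : ∀ m → sum (tabulate {n = m} (λ _ → 0)) ≡ 0
  constant zero = refl
  constant (suc m) = constant m

  go : ∀ {m} (k : Fin m) → sum (tabulate (λ i → if does (k Fin.≟ i) then v else 0)) ≡ v
  go {suc m} zero = trans (cong (v ℕ.+_) (constant m)) (ℕ.+-identityʳ v)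
  go (suc k) = go k

toℕ<suc : ∀ {n} {x i : Fin n} → toℕ x < suc (toℕ i) → (toℕ x < toℕ i) ⊎ (x ≡ i)
toℕ<suc (s≤s x≤i) with ℕ.m≤n⇒m<n∨m≡n x≤i
... | inj₁ x<i = inj₁ x<i
... | inj₂ x≡i = inj₂ (Fin.toℕ-injective x≡i)

allFin-take : ∀ n → take n (allFin n) ≡ allFin n
allFin-take n = take-all n (allFin n) (ℕ.≤-reflexive (length-tabulate id))

-- Greedy assignment and its load invariant

module Greedy {m n : ℕ} (I : Instance m n) where
  open Instance I

  -- With `allFin n` as the list this is `load` definitionally; a general list allows induction and
  -- gives the loads of partial schedules.
  loadOf : Assignment m n → List (Fin n) → Fin m → ℕ
  loadOf σ js i = sum (map p (filter (λ j → σ j Fin.≟ i) js))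

  share : Assignment m n → Fin n → Fin m → ℕ
  share σ j i = if does (σ j Fin.≟ i) then p j else 0

  loadOf-∷ : ∀ σ j js i →
    loadOf σ (j ∷ js) i ≡ share σ j i + loadOf σ js i
  loadOf-∷ σ j js i with does (σ j Fin.≟ i)
  ... | true = refl
  ... | false = refl

  loadOf-∷ʳ : ∀ σ j js i →
    loadOf σ (js ∷ʳ j) i ≡ loadOf σ js i + share σ j i
  loadOf-∷ʳ σ j [] i = trans (loadOf-∷ σ j [] i) (ℕ.+-identityʳ _)
  loadOf-∷ʳ σ j (x ∷ js) i = begin
    loadOf σ (x ∷ js ∷ʳ j) i                   ≡⟨ loadOf-∷ σ x (js ∷ʳ j) i ⟩
    share σ x i + loadOf σ (js ∷ʳ j) i         ≡⟨ cong (share σ x i ℕ.+_) (loadOf-∷ʳ σ j js i) ⟩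
    share σ x i + (loadOf σ js i + share σ j i)
      ≡⟨ ℕ.+-assoc (share σ x i) (loadOf σ js i) (share σ j i) ⟨
    share σ x i + loadOf σ js i + share σ j i  ≡⟨ cong (_+ share σ j i) (loadOf-∷ σ x js i) ⟨
    loadOf σ (x ∷ js) i + share σ j i          ∎
    where open ≡-Reasoning

  loadOf-cong : ∀ {σ τ js} i → All (λ j → σ j ≡ τ j) js → loadOf σ js i ≡ loadOf τ js i
  loadOf-cong i [] = refl
  loadOf-cong {σ} {τ} {j ∷ js} i (σj≡τj ∷ eqs)
    rewrite loadOf-∷ σ j js i | loadOf-∷ τ j js i | σj≡τj | loadOf-cong {js = js} i eqs = refl

  -- Double counting: each job adds its time to exactly one machine.
  sum-loadOf : ∀ σ js → sum (map (loadOf σ js) (allFin m)) ≡ sum (map p js)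
  sum-loadOf σ [] = sum-map-0 (allFin m)
  sum-loadOf σ (j ∷ js) = begin
    sum (map (loadOf σ (j ∷ js)) (allFin m))
      ≡⟨ sum-map-cong (allFin m) (loadOf-∷ σ j js) ⟩
    sum (map (λ i → share σ j i + loadOf σ js i) (allFin m))
      ≡⟨ sum-map-+ (share σ j) (loadOf σ js) (allFin m) ⟩
    sum (map (share σ j) (allFin m))
      + sum (map (loadOf σ js) (allFin m))
      ≡⟨ cong₂ _+_ (sum-indicator (σ j) (p j)) (sum-loadOf σ js) ⟩
    p j + sum (map p js) ∎
    where open ≡-Reasoning

  p≤pmax : ∀ j → p j ≤ pmax I
  p≤pmax j = All.lookup (xs≤max 0 (map p (allFin n))) (∈-map⁺ p (∈-allFin j))

  minMachines≤machinesFor : ∀ j → minMachines I ≤ machinesFor I j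
  minMachines≤machinesFor j =
    All.lookup (min≤xs m (map (machinesFor I) (allFin n))) (∈-map⁺ (machinesFor I) (∈-allFin j))

  jobsBefore : ℕ → List (Fin n)
  jobsBefore k = take k (allFin n)

  partialLoad : Assignment m n → ℕ → Fin m → ℕ
  partialLoad σ k = loadOf σ (jobsBefore k)

  reassign : Assignment m n → Fin n → Fin m → Assignment m n
  reassign σ j b x = if does (x Fin.≟ j) then b else σ x

  reassign-at : ∀ σ j b → reassign σ j b j ≡ b
  reassign-at σ j b rewrite dec-true (j Fin.≟ j) refl = refl

  reassign-before : ∀ σ j b x → toℕ x < toℕ j → reassign σ j b x ≡ σ x
  reassign-before σ j b x x<j
    rewrite dec-false (x Fin.≟ j) (λ { refl → ℕ.<-irrefl refl x<j }) = refl

  -- Job `j` lies outside the prefix of jobs before it, so moving `j` leaves the old loads alone and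
  -- only the new last entry of the longer prefix adds to them.
  partialLoad-reassign : ∀ σ j b i →
    partialLoad (reassign σ j b) (suc (toℕ j)) i
      ≡ partialLoad σ (toℕ j) i + (if does (b Fin.≟ i) then p j else 0)
  partialLoad-reassign σ j b i = begin
    loadOf τ (jobsBefore (suc (toℕ j))) i
      ≡⟨ cong (λ js → loadOf τ js i) (take-suc-tabulate id j) ⟩
    loadOf τ (jobsBefore (toℕ j) ∷ʳ j) i
      ≡⟨ loadOf-∷ʳ τ j (jobsBefore (toℕ j)) i ⟩
    loadOf τ (jobsBefore (toℕ j)) i + share τ j i
      ≡⟨ cong₂ (λ l k → l + (if does (k Fin.≟ i) then p j else 0))
           (loadOf-cong i (All-take-tabulate (toℕ j) (reassign-before σ j b)))
           (reassign-at σ j b) ⟩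
    partialLoad σ (toℕ j) i + (if does (b Fin.≟ i) then p j else 0) ∎
    where
    open ≡-Reasoning
    τ : Assignment m n
    τ = reassign σ j b

  work : ℕ → ℕ
  work k = sum (map p (jobsBefore k))

  work-suc : ∀ j → work (suc (toℕ j)) ≡ work (toℕ j) + p j
  work-suc j = begin
    sum (map p (jobsBefore (suc (toℕ j))))
      ≡⟨ cong (sum ∘ map p) (take-suc-tabulate id j) ⟩
    sum (map p (jobsBefore (toℕ j) ∷ʳ j))
      ≡⟨ cong sum (map-++ p (jobsBefore (toℕ j)) [ j ]) ⟩
    sum (map p (jobsBefore (toℕ j)) ++ [ p j ])
      ≡⟨ sum-++ (map p (jobsBefore (toℕ j))) [ p j ] ⟩
    work (toℕ j) + (p j + 0)
      ≡⟨ cong (work (toℕ j) ℕ.+_) (ℕ.+-identityʳ (p j)) ⟩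
    work (toℕ j) + p j ∎
    where open ≡-Reasoning

  -- The conditions concern the values of `σ` on the first `k` jobs. The balance inequality is
  -- multiplied by `minMachines` to stay in ℕ, and it charges only the work placed so far.
  record PartialSchedule (k : ℕ) (σ : Assignment m n) : Set where
    field
      feasible : ∀ j → toℕ j < k → ptime (σ j) j <⁺ ⊤⁺
      balanced : ∀ i → minMachines I * partialLoad σ k i ≤ minMachines I * pmax I + work k
  open PartialSchedule

  emptySchedule : ∀ σ → PartialSchedule 0 σ
  emptySchedule σ .feasible j ()
  emptySchedule σ .balanced i rewrite ℕ.*-zeroʳ (minMachines I) = z≤n

  LeastLoaded : Assignment m n → Fin n → Fin m → Set
  LeastLoaded σ j b = ∀ i → ptime i j <⁺ ⊤⁺ → partialLoad σ (toℕ j) b ≤ partialLoad σ (toℕ j) i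

  extend : ∀ {σ j b} → PartialSchedule (toℕ j) σ → ptime b j <⁺ ⊤⁺ → LeastLoaded σ j b →
    PartialSchedule (suc (toℕ j)) (reassign σ j b)
  extend {σ} {j} {b} S b-finite least .feasible x x<1+j with toℕ<suc {x = x} {j} x<1+j
  ... | inj₁ x<j rewrite reassign-before σ j b x x<j = feasible S x x<j
  ... | inj₂ refl rewrite reassign-at σ j b = b-finite
  extend {σ} {j} {b} S b-finite least .balanced i
    rewrite partialLoad-reassign σ j b i | work-suc j with b Fin.≟ i
  -- A machine other than `b` keeps its load, while the right-hand side grows by `p j`.
  ... | no _ rewrite ℕ.+-identityʳ (partialLoad σ (toℕ j) i) = ℕ.≤-trans (balanced S i)
          (ℕ.+-monoʳ-≤ (minMachines I * pmax I) (ℕ.m≤m+n (work (toℕ j)) (p j)))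
  ... | yes refl = begin
    minMachines I * (partialLoad σ (toℕ j) b + p j)
      ≡⟨ ℕ.*-distribˡ-+ (minMachines I) (partialLoad σ (toℕ j) b) (p j) ⟩
    minMachines I * partialLoad σ (toℕ j) b + minMachines I * p j
      -- The old load of `b` is charged to the machines able to run `j`, of which there are at least
      -- `minMachines`; the new job is charged to `pmax`.
      ≤⟨ ℕ.+-mono-≤ (ℕ.*-monoˡ-≤ (partialLoad σ (toℕ j) b) (minMachines≤machinesFor j))
           (ℕ.*-monoʳ-≤ (minMachines I) (p≤pmax j)) ⟩
    machinesFor I j * partialLoad σ (toℕ j) b + minMachines I * pmax I
      ≤⟨ ℕ.+-monoˡ-≤ (minMachines I * pmax I)
           (length-filter*≤sum (λ i → finite? I i j) (partialLoad σ (toℕ j))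
              (partialLoad σ (toℕ j) b) least (allFin m)) ⟩
    sum (map (partialLoad σ (toℕ j)) (allFin m)) + minMachines I * pmax I
      ≡⟨ cong (_+ minMachines I * pmax I) (sum-loadOf σ (jobsBefore (toℕ j))) ⟩
    work (toℕ j) + minMachines I * pmax I
      ≡⟨ ℕ.+-comm (work (toℕ j)) (minMachines I * pmax I) ⟩
    minMachines I * pmax I + work (toℕ j)
      ≤⟨ ℕ.+-monoʳ-≤ (minMachines I * pmax I) (ℕ.m≤m+n (work (toℕ j)) (p j)) ⟩
    minMachines I * pmax I + (work (toℕ j) + p j) ∎
    where open ℕ.≤-Reasoning

  complete-feasible : ∀ {σ} → PartialSchedule n σ → Feasible I σ
  complete-feasible S j = feasible S j (Fin.toℕ<n j)

  complete-makespan : ∀ {σ} → PartialSchedule n σ →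
    minMachines I * makespan I σ ≤ minMachines I * pmax I + totalTime I
  -- The maximum is the seed 0 or one of the loads, so both are checked.
  complete-makespan {σ} S = argmax-all id {P = λ l → minMachines I * l ≤ _}
    (ℕ.≤-trans (ℕ.≤-reflexive (ℕ.*-zeroʳ (minMachines I))) z≤n)
    (All.map⁺ (All.universal load-bound (allFin m)))
    where
    load-bound : ∀ i → minMachines I * load I σ i ≤ minMachines I * pmax I + totalTime I
    load-bound i = subst
      (λ js → minMachines I * loadOf σ js i ≤ minMachines I * pmax I + sum (map p js))
      (allFin-take n) (balanced S i)

-- Natural numbers inside the rationals

ℕ⇒ℚ-homo-+ : ∀ a b → ℕ⇒ℚ (a + b) ≡ ℕ⇒ℚ a ℚ.+ ℕ⇒ℚ b
ℕ⇒ℚ-homo-+ a b = ℚ.toℚᵘ-injective (begin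
  ℚ.toℚᵘ (ℕ⇒ℚ (a + b))                   ≈⟨ ℚ.toℚᵘ-fromℚᵘ (mkℚᵘ (+ (a + b)) 0) ⟩
  mkℚᵘ (+ (a + b)) 0                     ≈⟨ *≡* (cong (ℤ._* + 1)
      (sym (cong₂ ℤ._+_ (ℤ.*-identityʳ (+ a)) (ℤ.*-identityʳ (+ b))))) ⟩
  mkℚᵘ (+ a) 0 ℚᵘ.+ mkℚᵘ (+ b) 0         ≈⟨ ℚᵘ.+-cong (ℚ.toℚᵘ-fromℚᵘ (mkℚᵘ (+ a) 0)) (ℚ.toℚᵘ-fromℚᵘ (mkℚᵘ (+ b) 0)) ⟨
  ℚ.toℚᵘ (ℕ⇒ℚ a) ℚᵘ.+ ℚ.toℚᵘ (ℕ⇒ℚ b)     ≈⟨ ℚ.toℚᵘ-homo-+ (ℕ⇒ℚ a) (ℕ⇒ℚ b) ⟨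
  ℚ.toℚᵘ (ℕ⇒ℚ a ℚ.+ ℕ⇒ℚ b)               ∎)
  where open ℚᵘ.≃-Reasoning

ℕ⇒ℚ-homo-* : ∀ a b → ℕ⇒ℚ (a * b) ≡ ℕ⇒ℚ a ℚ.* ℕ⇒ℚ b
ℕ⇒ℚ-homo-* a b = ℚ.toℚᵘ-injective (begin
  ℚ.toℚᵘ (ℕ⇒ℚ (a * b))                   ≈⟨ ℚ.toℚᵘ-fromℚᵘ (mkℚᵘ (+ (a * b)) 0) ⟩
  mkℚᵘ (+ (a * b)) 0                     ≈⟨ *≡* (cong (ℤ._* + 1) (ℤ.pos-* a b)) ⟩
  mkℚᵘ (+ a) 0 ℚᵘ.* mkℚᵘ (+ b) 0         ≈⟨ ℚᵘ.*-cong (ℚ.toℚᵘ-fromℚᵘ (mkℚᵘ (+ a) 0)) (ℚ.toℚᵘ-fromℚᵘ (mkℚᵘ (+ b) 0)) ⟨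
  ℚ.toℚᵘ (ℕ⇒ℚ a) ℚᵘ.* ℚ.toℚᵘ (ℕ⇒ℚ b)     ≈⟨ ℚ.toℚᵘ-homo-* (ℕ⇒ℚ a) (ℕ⇒ℚ b) ⟨
  ℚ.toℚᵘ (ℕ⇒ℚ a ℚ.* ℕ⇒ℚ b)               ∎)
  where open ℚᵘ.≃-Reasoning

ℕ⇒ℚ-mono-≤ : ∀ {a b} → a ≤ b → ℕ⇒ℚ a ℚ.≤ ℕ⇒ℚ b
ℕ⇒ℚ-mono-≤ {a} {b} a≤b = ℚ.toℚᵘ-cancel-≤ (begin
  ℚ.toℚᵘ (ℕ⇒ℚ a)     ≃⟨ ℚ.toℚᵘ-fromℚᵘ (mkℚᵘ (+ a) 0) ⟩
  mkℚᵘ (+ a) 0       ≤⟨ *≤* (ℤ.*-monoʳ-≤-nonNeg (+ 1) (ℤ.+≤+ a≤b)) ⟩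
  mkℚᵘ (+ b) 0       ≃⟨ ℚ.toℚᵘ-fromℚᵘ (mkℚᵘ (+ b) 0) ⟨
  ℚ.toℚᵘ (ℕ⇒ℚ b)     ∎)
  where open ℚᵘ.≤-Reasoning

-- Turns `m` times `φ` into `minMachines`, and `m` times the average load into `totalTime`.
d*[k/d]≡k : ∀ k d .{{_ : NonZero d}} → ℕ⇒ℚ d ℚ.* (+ k / d) ≡ ℕ⇒ℚ k
d*[k/d]≡k k d@(suc d-1) = ℚ.toℚᵘ-injective (begin
  ℚ.toℚᵘ (ℕ⇒ℚ d ℚ.* (+ k / d))           ≈⟨ ℚ.toℚᵘ-homo-* (ℕ⇒ℚ d) (+ k / d) ⟩
  ℚ.toℚᵘ (ℕ⇒ℚ d) ℚᵘ.* ℚ.toℚᵘ (+ k / d)   ≈⟨ ℚᵘ.*-cong (ℚ.toℚᵘ-fromℚᵘ (mkℚᵘ (+ d) 0)) (ℚ.toℚᵘ-fromℚᵘ (mkℚᵘ (+ k) d-1)) ⟩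
  mkℚᵘ (+ d) 0 ℚᵘ.* mkℚᵘ (+ k) d-1       ≈⟨ *≡* dk1≡kd ⟩
  mkℚᵘ (+ k) 0                           ≈⟨ ℚ.toℚᵘ-fromℚᵘ (mkℚᵘ (+ k) 0) ⟨
  ℚ.toℚᵘ (ℕ⇒ℚ k)                         ∎)
  where
  open ℚᵘ.≃-Reasoning
  dk1≡kd : + d ℤ.* + k ℤ.* + 1 ≡ + k ℤ.* + (1 * d)
  dk1≡kd rewrite ℕ.*-identityˡ d = trans (ℤ.*-identityʳ (+ d ℤ.* + k)) (ℤ.*-comm (+ d) (+ k))

÷-unique : ∀ x y z .{{_ : ℚ.NonZero y}} → x ℚ.* y ≡ z → x ≡ z ÷ y
÷-unique x y z refl = begin
  x                         ≡⟨ ℚ.*-identityʳ x ⟨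
  x ℚ.* ℚ.1ℚ                ≡⟨ cong (x ℚ.*_) (ℚ.*-inverseʳ y) ⟨
  x ℚ.* (y ℚ.* ℚ.1/ y)      ≡⟨ ℚ.*-assoc x y (ℚ.1/ y) ⟨
  x ℚ.* y ℚ.* ℚ.1/ y        ∎
  where open ≡-Reasoning

[x÷y]*y≡x : ∀ x y .{{_ : ℚ.NonZero y}} → (x ÷ y) ℚ.* y ≡ x
[x÷y]*y≡x x y = begin
  x ℚ.* ℚ.1/ y ℚ.* y        ≡⟨ ℚ.*-assoc x (ℚ.1/ y) y ⟩
  x ℚ.* (ℚ.1/ y ℚ.* y)      ≡⟨ cong (x ℚ.*_) (ℚ.*-inverseˡ y) ⟩
  x ℚ.* ℚ.1ℚ                ≡⟨ ℚ.*-identityʳ x ⟩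
  x                         ∎
  where open ≡-Reasoning

-- The makespan bound over the rationals

module Bound {m n : ℕ} .{{_ : NonZero m}} (I : Instance m n) where
  open Greedy I

  averageLoad≡ : ∀ σ → averageLoad I σ ≡ + totalTime I / m
  averageLoad≡ σ = cong (λ t → + t / m) (sum-loadOf σ (allFin n))

  -- All assignments share one average load, so the minimum, seed included, is that common value.
  Lopt≡ : Lopt I ≡ + totalTime I / m
  Lopt≡ = Extrema.argmin-all (DecTotalOrder.totalOrder ℚ.≤-decTotalOrder) id
    {xs = map (averageLoad I) (optimalAssignments I)} {P = _≡ + totalTime I / m}
    (averageLoad≡ (someOptimal I))
    (All.map⁺ (All.universal averageLoad≡ (optimalAssignments I)))

  bound : ℚ
  bound = (Lopt I ÷ φ I) {{φ-nonZero I}}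

  -- Cancelling `φ` leaves `Lopt` times `m`. The equation determines the quotient, and so identifies
  -- the two forms of the bound.
  bound*mφ : bound ℚ.* (ℕ⇒ℚ m ℚ.* φ I) ≡ ℕ⇒ℚ (totalTime I)
  bound*mφ = begin
    bound ℚ.* (ℕ⇒ℚ m ℚ.* φ I)
      ≡⟨ cong (bound ℚ.*_) (ℚ.*-comm (ℕ⇒ℚ m) (φ I)) ⟩
    bound ℚ.* (φ I ℚ.* ℕ⇒ℚ m)
      ≡⟨ ℚ.*-assoc bound (φ I) (ℕ⇒ℚ m) ⟨
    bound ℚ.* φ I ℚ.* ℕ⇒ℚ m
      ≡⟨ cong (ℚ._* ℕ⇒ℚ m) ([x÷y]*y≡x (Lopt I) (φ I) {{φ-nonZero I}}) ⟩
    Lopt I ℚ.* ℕ⇒ℚ m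
      ≡⟨ cong (ℚ._* ℕ⇒ℚ m) Lopt≡ ⟩
    (+ totalTime I / m) ℚ.* ℕ⇒ℚ m
      ≡⟨ ℚ.*-comm (+ totalTime I / m) (ℕ⇒ℚ m) ⟩
    ℕ⇒ℚ m ℚ.* (+ totalTime I / m)
      ≡⟨ d*[k/d]≡k (totalTime I) m ⟩
    ℕ⇒ℚ (totalTime I) ∎
    where open ≡-Reasoning

  bound≡ : bound ≡ (ℕ⇒ℚ (totalTime I) ÷ (ℕ⇒ℚ m ℚ.* φ I)) {{mφ-nonZero I}}
  bound≡ = ÷-unique bound (ℕ⇒ℚ m ℚ.* φ I) (ℕ⇒ℚ (totalTime I)) {{mφ-nonZero I}} bound*mφ

  bound*minMachines : bound ℚ.* ℕ⇒ℚ (minMachines I) ≡ ℕ⇒ℚ (totalTime I)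
  bound*minMachines =
    trans (cong (bound ℚ.*_) (sym (d*[k/d]≡k (minMachines I) m))) bound*mφ

  -- Multiplying by the positive `minMachines` clears the quotient and leaves the inequality in ℕ.
  makespan≤ : ∀ L → minMachines I * L ≤ minMachines I * pmax I + totalTime I →
    ℕ⇒ℚ L ℚ.≤ ℕ⇒ℚ (pmax I) ℚ.+ bound
  makespan≤ L cL≤ = ℚ.*-cancelʳ-≤-pos (ℕ⇒ℚ c)
    {{ℚ.normalize-pos c 1 {{_}} {{ℕ.>-nonZero (minMachines>0 I)}}}} (begin
    ℕ⇒ℚ L ℚ.* ℕ⇒ℚ c
      ≡⟨ ℚ.*-comm (ℕ⇒ℚ L) (ℕ⇒ℚ c) ⟩
    ℕ⇒ℚ c ℚ.* ℕ⇒ℚ L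
      ≡⟨ ℕ⇒ℚ-homo-* c L ⟨
    ℕ⇒ℚ (c * L)
      ≤⟨ ℕ⇒ℚ-mono-≤ cL≤ ⟩
    ℕ⇒ℚ (c * pmax I + totalTime I)
      ≡⟨ ℕ⇒ℚ-homo-+ (c * pmax I) (totalTime I) ⟩
    ℕ⇒ℚ (c * pmax I) ℚ.+ ℕ⇒ℚ (totalTime I)
      ≡⟨ cong₂ ℚ._+_ (trans (cong ℕ⇒ℚ (ℕ.*-comm c (pmax I))) (ℕ⇒ℚ-homo-* (pmax I) c))
           (sym bound*minMachines) ⟩
    ℕ⇒ℚ (pmax I) ℚ.* ℕ⇒ℚ c ℚ.+ bound ℚ.* ℕ⇒ℚ c
      ≡⟨ ℚ.*-distribʳ-+ (ℕ⇒ℚ c) (ℕ⇒ℚ (pmax I)) bound ⟨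
    (ℕ⇒ℚ (pmax I) ℚ.+ bound) ℚ.* ℕ⇒ℚ c ∎)
    where
    open ℚ.≤-Reasoning
    c : ℕ
    c = minMachines I

-- Program runs with a step budget

-- `stop` may leave budget unspent, so `b` is an upper bound. It may also occur at a state that has
-- not halted, which lets runs be chained.
data Run (P : Program) : State → ℕ → (State → Set) → Set₁ where
  stop : ∀ {s b Q} → Q s → Run P s b Q
  step : ∀ {s b Q ins} → fetch P (pc s) ≡ just ins → Run P (exec ins s) b Q → Run P s (suc b) Q

module _ {P : Program} where

  weaken : ∀ {s b b′ Q} → b ≤ b′ → Run P s b Q → Run P s b′ Q
  weaken b≤b′ (stop q) = stop q
  weaken (s≤s b≤b′) (step f r) = step f (weaken b≤b′ r)

  infixr 1 _then_
  _then_ : ∀ {s b b′ Q Q′} → Run P s b Q → (∀ {s′} → Q s′ → Run P s′ b′ Q′) → Run P s (b + b′) Q′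
  _then_ {b = b} (stop q) k = weaken (ℕ.m≤n+m _ b) (k q)
  step f r then k = step f (r then k)

  -- The next program counter is an `if` whose test is stuck for an abstract register; the equation
  -- resolves it.
  step-zero : ∀ {c R M b Q r l} → fetch P c ≡ just (jzero r l) → R r ≡ 0 →
    Run P ⟨ l , R , M ⟩ b Q → Run P ⟨ c , R , M ⟩ (suc b) Q
  step-zero {c} {R} {M} {b} {Q} {r} {l} f R≡0 k = step f
    (subst (λ t → Run P ⟨ (if t then l else suc c) , R , M ⟩ b Q)
       (sym (dec-true (R r ℕ.≟ 0) R≡0)) k)

  step-nonzero : ∀ {c R M b Q r l} → fetch P c ≡ just (jzero r l) → R r ≢ 0 →
    Run P ⟨ suc c , R , M ⟩ b Q → Run P ⟨ c , R , M ⟩ (suc b) Q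
  step-nonzero {c} {R} {M} {b} {Q} {r} {l} f R≢0 k = step f
    (subst (λ t → Run P ⟨ (if t then l else suc c) , R , M ⟩ b Q)
       (sym (dec-false (R r ℕ.≟ 0) R≢0)) k)

  -- The loop rule. In `Inv k d`, `k` counts finished rounds, which the invariant speaks of, and `d`
  -- the rounds left, which the machine's counter holds.
  iterate : ∀ {N b} (Inv : ℕ → ℕ → State → Set) →
    (∀ (i : Fin N) {d s} → Inv (toℕ i) (suc d) s → Run P s b (Inv (suc (toℕ i)) d)) →
    ∀ k d → k + d ≡ N → ∀ {s} → Inv k d s → Run P s (d * b) (Inv N 0)
  iterate {N} Inv body k zero k+0≡N {s} inv =
    stop (subst (λ k → Inv k 0 s) (trans (sym (ℕ.+-identityʳ k)) k+0≡N) inv)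
  iterate {N} {b} Inv body k (suc d) k+1+d≡N {s} inv =
    body′ inv then iterate Inv body (suc k) d (trans (sym (ℕ.+-suc k d)) k+1+d≡N)
    where
    k<N : k < N
    k<N = subst (k <_) k+1+d≡N (ℕ.m<m+n k (s≤s z≤n))
    body′ : Inv k (suc d) s → Run P s b (Inv (suc k) d)
    body′ = subst (λ k → Inv k (suc d) s → Run P s b (Inv (suc k) d))
      (Fin.toℕ-fromℕ< k<N) (body (fromℕ< k<N))

  halts : ∀ {s b} {Q : State → Set} → Run P s b (λ s′ → fetch P (pc s′) ≡ nothing × Q s′) →
    ∃[ t ] ∃[ s′ ] ((P ⊢ s ⇓[ t ] s′) × t ≤ b × Q s′)
  halts (stop (f , q)) = 0 , _ , halt f , z≤n , q
  halts (step f r) with t , s′ , e , t≤b , q ← halts r = suc t , s′ , next f e , s≤s t≤b , q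

-- Memory: the input, then (from n * m) the loads of the m machines, then the output.
-- Registers: 0: m, 1: jobs left, 2: 1, 3: n * m, 4: loop counter, 6: output cell,
-- 7: input cell, 8: load cell; 9: 1 + the load of the best machine so far (0 if there
-- is none), 10: its load cell, 14: 1 + the processing time; 11, 12, 13: scratch.
listScheduling : Program
listScheduling =
  set 2 1 ∷
  copy 4 1 ∷
  jzero 4 6 ∷       -- 2: n * m by repeated addition
  add 3 3 0 ∷
  sub 4 4 2 ∷
  jump 2 ∷
  add 6 3 0 ∷
  jzero 1 35 ∷      -- 7: next job
  set 9 0 ∷
  copy 8 3 ∷
  copy 4 0 ∷
  jzero 4 26 ∷      -- 11: next machine
  read 11 7 ∷
  jzero 11 22 ∷
  read 12 8 ∷
  add 12 12 2 ∷
  jzero 9 19 ∷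
  sub 13 9 12 ∷
  jzero 13 22 ∷
  copy 9 12 ∷       -- 19: new best machine
  copy 10 8 ∷
  copy 14 11 ∷
  add 7 7 2 ∷       -- 22
  add 8 8 2 ∷
  sub 4 4 2 ∷
  jump 11 ∷
  add 9 9 14 ∷      -- 26: assign the job
  sub 9 9 2 ∷
  sub 9 9 2 ∷
  write 10 9 ∷
  sub 10 10 3 ∷
  write 6 10 ∷
  add 6 6 2 ∷
  sub 1 1 2 ∷
  jump 7 ∷
  add 0 3 0 ∷       -- 35
  []

-- Correctness and step count of the program

module Simulation {m n : ℕ} (I : Instance m n) where
  open Instance I
  open Greedy I

  Finite : Fin m → Fin n → Set
  Finite i j = ptime i j <⁺ ⊤⁺

  InputIn : (ℕ → ℕ) → Set
  InputIn M = ∀ i j → M (toℕ j * m + toℕ i) ≡ encode∞ (ptime i j)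

  LoadsIn : (ℕ → ℕ) → (Fin m → ℕ) → Set
  LoadsIn M l = ∀ i → M (n * m + toℕ i) ≡ l i

  OutputsIn : (ℕ → ℕ) → ℕ → Assignment m n → Set
  OutputsIn M k σ = ∀ j → toℕ j < k → M (n * m + m + toℕ j) ≡ toℕ (σ j)

  toℕ-combine′ : ∀ (j : Fin n) (i : Fin m) → toℕ (combine j i) ≡ toℕ j * m + toℕ i
  toℕ-combine′ j i = trans (Fin.toℕ-combine j i) (cong (_+ toℕ i) (ℕ.*-comm m (toℕ j)))

  input-cell< : ∀ j i → toℕ j * m + toℕ i < n * m
  input-cell< j i = subst (_< n * m) (toℕ-combine′ j i) (Fin.toℕ<n (combine j i))

  -- Cell `j * m + i` is the number of `combine j i`, and `remQuot` undoes `combine`.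
  inputMemory-input : InputIn (inputMemory I)
  inputMemory-input i j with toℕ j * m + toℕ i ℕ.<? n * m
  ... | no ≮ = contradiction (input-cell< j i) ≮
  ... | yes a<nm = trans
    (cong (λ f → let (j′ , i′) = remQuot {n} m f in encode∞ (ptime i′ j′))
       (Fin.toℕ-injective (trans (Fin.toℕ-fromℕ< a<nm) (sym (toℕ-combine′ j i)))))
    (cong (λ (j′ , i′) → encode∞ (ptime i′ j′)) (Fin.remQuot-combine j i))

  -- The load array of the empty schedule is thus in place from the start.
  inputMemory-beyond : ∀ x → inputMemory I (n * m + x) ≡ 0
  inputMemory-beyond x with n * m + x ℕ.<? n * m
  ... | no _ = refl
  ... | yes a<nm = contradiction a<nm (ℕ.m+n≮m (n * m) x)

  data Code (i : Fin m) (j : Fin n) : Set where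
    infinite : encode∞ (ptime i j) ≡ 0 → ¬ Finite i j → Code i j
    finite   : encode∞ (ptime i j) ≡ suc (p j) → Finite i j → Code i j

  code : ∀ i j → Code i j
  code i j with restricted i j
  ... | inj₁ e = finite (cong encode∞ e) (subst (_<⁺ ⊤⁺) (sym e) [ p j ]<⊤⁺)
  ... | inj₂ e = infinite (cong encode∞ e) λ fin → case-⊤ (subst (_<⁺ ⊤⁺) e fin)
    where
    case-⊤ : ¬ (⊤⁺ <⁺ ⊤⁺)
    case-⊤ ()

  -- The registers that a scan over the machines preserves. Register numbers are literals, so
  -- lookups after an update compute and one proof of `Frame` serves across many instructions.
  Frame : ℕ → ℕ → (ℕ → ℕ) → Set
  Frame d out R = R 0 ≡ m × R 1 ≡ d × R 2 ≡ 1 × R 3 ≡ n * m × R 6 ≡ out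

  -- The state of the search after `k` machines. Storing the load plus one frees 0 to signal that no
  -- eligible machine has been seen.
  data Best (l : Fin m → ℕ) (j : Fin n) (k : ℕ) (load+1 cell time+1 : ℕ) : Set where
    none : load+1 ≡ 0 → (∀ i → toℕ i < k → ¬ Finite i j) → Best l j k load+1 cell time+1
    some : ∀ b → Finite b j → load+1 ≡ suc (l b) → cell ≡ n * m + toℕ b → time+1 ≡ suc (p j) →
      (∀ i → toℕ i < k → Finite i j → l b ≤ l i) → Best l j k load+1 cell time+1

  extend-below : ∀ {j} i {Q : Fin m → Set} → (∀ i′ → toℕ i′ < toℕ i → Finite i′ j → Q i′) →
    (Finite i j → Q i) → ∀ i′ → toℕ i′ < suc (toℕ i) → Finite i′ j → Q i′
  extend-below i below at i′ i′<1+i with toℕ<suc {x = i′} {i} i′<1+i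
  ... | inj₁ i′<i = below i′ i′<i
  ... | inj₂ refl = at

  skip-infinite : ∀ {l j} i {x y z} → ¬ Finite i j → Best l j (toℕ i) x y z → Best l j (suc (toℕ i)) x y z
  skip-infinite i i-inf (none e ∄) = none e (extend-below i ∄ i-inf)
  skip-infinite i i-inf (some b b-fin e₁ e₂ e₃ least) =
    some b b-fin e₁ e₂ e₃ (extend-below i least λ fin → contradiction fin i-inf)

  -- Invariant of the machine loop at its entry, instruction 11, with `k` machines examined and `e`
  -- left. The scan only reads, so `M` is fixed.
  data Scanned (l : Fin m → ℕ) (j : Fin n) (d out : ℕ) (M : ℕ → ℕ) (k e : ℕ) : State → Set where
    scanned : ∀ {R} → Frame d out R → R 4 ≡ e → R 7 ≡ toℕ j * m + k → R 8 ≡ n * m + k →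
      Best l j k (R 9) (R 10) (R 14) → Scanned l j d out M k e ⟨ 11 , R , M ⟩

  +-suc′ : ∀ {x y} a k → x ≡ a + k → y ≡ 1 → x + y ≡ a + suc k
  +-suc′ a k refl refl = trans (ℕ.+-assoc a k 1) (cong (a ℕ.+_) (ℕ.+-comm k 1))

  module _ {l : Fin m → ℕ} {j : Fin n} {d out : ℕ} {M : ℕ → ℕ} (input : InputIn M) (loads : LoadsIn M l) where

    advance : ∀ (i : Fin m) {e R} → Frame d out R → R 4 ≡ suc e → R 7 ≡ toℕ j * m + toℕ i →
      R 8 ≡ n * m + toℕ i → Best l j (suc (toℕ i)) (R 9) (R 10) (R 14) →
      Run listScheduling ⟨ 22 , R , M ⟩ 4 (Scanned l j d out M (suc (toℕ i)) e)
    advance i F@(_ , _ , r₂ , _) r₄ r₇ r₈ best =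
      step refl (step refl (step refl (step refl (stop
        (scanned F (cong₂ _∸_ r₄ r₂) (+-suc′ (toℕ j * m) (toℕ i) r₇ r₂)
          (+-suc′ (n * m) (toℕ i) r₈ r₂) best)))))

    new-best : ∀ i {e R} → Frame d out R → R 4 ≡ suc e → R 7 ≡ toℕ j * m + toℕ i →
      R 8 ≡ n * m + toℕ i → R 11 ≡ suc (p j) → R 12 ≡ suc (l i) → Finite i j →
      (∀ i′ → toℕ i′ < toℕ i → Finite i′ j → l i ≤ l i′) →
      Run listScheduling ⟨ 19 , R , M ⟩ 7 (Scanned l j d out M (suc (toℕ i)) e)
    new-best i F r₄ r₇ r₈ r₁₁ r₁₂ i-fin least = step refl (step refl (step refl
      (advance i F r₄ r₇ r₈ (some i i-fin r₁₂ r₈ r₁₁ (extend-below i least λ _ → ℕ.≤-refl)))))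

    -- The longest path runs through instructions 11 to 25, hence the budget 15; shorter branches
    -- are padded by `weaken`.
    scan-machine : ∀ i {e s} → Scanned l j d out M (toℕ i) (suc e) s →
      Run listScheduling s 15 (Scanned l j d out M (suc (toℕ i)) e)
    scan-machine i {e} (scanned {R} F@(_ , _ , r₂ , _) r₄ r₇ r₈ best) =
      step-nonzero refl (λ r₄≡0 → contradiction (trans (sym r₄) r₄≡0) λ ())
        (step refl (examine (code i j)))
      where
      R₁ R₂ : ℕ → ℕ
      R₁ = R [ 11 ≔ M (R 7) ]
      R₂ = (R₁ [ 12 ≔ M (R 8) ]) [ 12 ≔ M (R 8) + R 2 ]

      code≡ : M (R 7) ≡ encode∞ (ptime i j)
      code≡ = trans (cong M r₇) (input i j)

      load≡ : M (R 8) + R 2 ≡ suc (l i)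
      load≡ = trans (cong₂ _+_ (trans (cong M r₈) (loads i)) r₂) (ℕ.+-comm (l i) 1)

      compare : encode∞ (ptime i j) ≡ suc (p j) → Finite i j → Best l j (toℕ i) (R 9) (R 10) (R 14) →
        Run listScheduling ⟨ 16 , R₂ , M ⟩ 10 (Scanned l j d out M (suc (toℕ i)) e)
      compare c i-fin (none r₉ ∄) =
        step-zero refl r₉ (weaken (ℕ.m≤n+m 7 2)
          (new-best i F r₄ r₇ r₈ (trans code≡ c) load≡ i-fin
            (λ i′ i′<i fin → contradiction fin (∄ i′ i′<i))))
      compare c i-fin (some b b-fin r₉ r₁₀ r₁₄ least) =
        step-nonzero refl (λ r₉≡0 → contradiction (trans (sym r₉) r₉≡0) λ ())
          (step refl (branch (l b ℕ.≤? l i)))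
        where
        diff≡ : R 9 ∸ (M (R 8) + R 2) ≡ l b ∸ l i
        diff≡ = cong₂ _∸_ r₉ load≡

        branch : Dec (l b ≤ l i) →
          Run listScheduling ⟨ 18 , R₂ [ 13 ≔ R 9 ∸ (M (R 8) + R 2) ] , M ⟩ 8
            (Scanned l j d out M (suc (toℕ i)) e)
        -- Truncated subtraction vanishes exactly when `l b ≤ l i`; the earlier machine is then
        -- kept, ties included.
        branch (yes lb≤li) = step-zero refl (trans diff≡ (ℕ.m≤n⇒m∸n≡0 lb≤li))
          (weaken (ℕ.m≤n+m 4 3) (advance i F r₄ r₇ r₈
            (some b b-fin r₉ r₁₀ r₁₄ (extend-below i least λ _ → lb≤li))))
        branch (no lb≰li) = step-nonzero refl
          (λ diff≡0 → ℕ.m>n⇒m∸n≢0 (ℕ.≰⇒> lb≰li) (trans (sym diff≡) diff≡0))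
          (new-best i F r₄ r₇ r₈ (trans code≡ c) load≡ i-fin λ i′ i′<i fin →
            ℕ.≤-trans (ℕ.<⇒≤ (ℕ.≰⇒> lb≰li)) (least i′ i′<i fin))

      examine : Code i j → Run listScheduling ⟨ 13 , R₁ , M ⟩ 13 (Scanned l j d out M (suc (toℕ i)) e)
      examine (infinite c i-inf) = step-zero refl (trans code≡ c)
        (weaken (ℕ.m≤n+m 4 8) (advance i F r₄ r₇ r₈ (skip-infinite i i-inf best)))
      examine (finite c i-fin) =
        step-nonzero refl (λ c≡0 → contradiction (trans (sym c) (trans (sym code≡) c≡0)) λ ())
          (step refl (step refl (compare c i-fin best)))

  -- Invariant of the job loop at its entry, instruction 7. The assignment `σ` lives in the proof;
  -- memory records its loads and its first `k` values.
  data Planned (k d : ℕ) : State → Set where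
    planned : ∀ {R M σ} → Frame d (n * m + m + k) R → R 7 ≡ k * m → InputIn M →
      LoadsIn M (partialLoad σ k) → OutputsIn M k σ → PartialSchedule k σ →
      Planned k d ⟨ 7 , R , M ⟩

  module _ {M : ℕ → ℕ} {σ : Assignment m n} (j : Fin n) (b : Fin m)
    (input : InputIn M) (loads : LoadsIn M (partialLoad σ (toℕ j))) (outs : OutputsIn M (toℕ j) σ) where

    private
      bCell outCell : ℕ
      bCell = n * m + toℕ b
      outCell = n * m + m + toℕ j

      M₁ M₂ : ℕ → ℕ
      M₁ = M [ bCell ≔ partialLoad σ (toℕ j) b + p j ]
      M₂ = M₁ [ outCell ≔ toℕ b ]

      load-cell< : ∀ (i : Fin m) x → n * m + toℕ i < n * m + m + x
      load-cell< i x = ℕ.<-≤-trans (ℕ.+-monoʳ-< (n * m) (Fin.toℕ<n i)) (ℕ.m≤m+n (n * m + m) x)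

    -- Input, loads and outputs follow one another in memory, and both written cells lie past the
    -- input.
    assign-input : InputIn M₂
    assign-input i j′ = trans
      (not-updated M₁ _ (ℕ.<⇒≢ (ℕ.<-trans (input-cell< j′ i)
        (ℕ.≤-<-trans (ℕ.m≤m+n (n * m) (toℕ b)) (load-cell< b (toℕ j))))))
      (trans
        (not-updated M _ (ℕ.<⇒≢ (ℕ.<-≤-trans (input-cell< j′ i) (ℕ.m≤m+n (n * m) (toℕ b)))))
        (input i j′))

    assign-loads : LoadsIn M₂ (partialLoad (reassign σ j b) (suc (toℕ j)))
    assign-loads i = trans (not-updated M₁ _ (ℕ.<⇒≢ (load-cell< i (toℕ j))))
      (trans new-load (sym (partialLoad-reassign σ j b i)))
      where
      new-load : M₁ (n * m + toℕ i) ≡ partialLoad σ (toℕ j) i + (if does (b Fin.≟ i) then p j else 0)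
      new-load with b Fin.≟ i
      ... | yes refl = updated M bCell _
      ... | no b≢i = trans
        (not-updated M _ (λ e → b≢i (sym (Fin.toℕ-injective (ℕ.+-cancelˡ-≡ (n * m) _ _ e)))))
        (trans (loads i) (sym (ℕ.+-identityʳ _)))

    assign-outputs : OutputsIn M₂ (suc (toℕ j)) (reassign σ j b)
    assign-outputs x x<1+j with toℕ<suc {x = x} {j} x<1+j
    ... | inj₂ refl = trans (updated M₁ outCell _) (cong toℕ (sym (reassign-at σ j b)))
    ... | inj₁ x<j = trans
      (not-updated M₁ _ (ℕ.<⇒≢ (ℕ.+-monoʳ-< (n * m + m) x<j)))
      (trans (not-updated M _ (ℕ.>⇒≢ (load-cell< b (toℕ x))))
        (trans (outs x x<j) (cong toℕ (sym (reassign-before σ j b x x<j)))))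

  assign-job : ∀ (j : Fin n) {d M σ s} → InputIn M → LoadsIn M (partialLoad σ (toℕ j)) →
    OutputsIn M (toℕ j) σ → PartialSchedule (toℕ j) σ →
    Scanned (partialLoad σ (toℕ j)) j (suc d) (n * m + m + toℕ j) M m 0 s →
    Run listScheduling s 10 (Planned (suc (toℕ j)) d)
  -- `coverage` supplies a machine able to run `j`, so the scan cannot end empty.
  assign-job j input loads outs S (scanned F r₄ r₇ r₈ (none _ ∄)) =
    contradiction (proj₂ (coverage j)) (∄ (proj₁ (coverage j)) (Fin.toℕ<n (proj₁ (coverage j))))
  assign-job j {d} {M} {σ} input loads outs S
    (scanned {R} (r₀ , r₁ , r₂ , r₃ , r₆) r₄ r₇ r₈ (some b b-fin r₉ r₁₀ r₁₄ least)) =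
    step-zero refl r₄ (step refl (step refl (step refl (step refl (step refl (step refl (step refl
      (step refl (step refl (stop planned-next))))))))))
    where
    -- Registers 9 and 14 both hold a value plus one, so their sum is lowered twice.
    v : ℕ
    v = R 9 + R 14 ∸ R 2 ∸ R 2

    R′ : ℕ → ℕ
    R′ = (((((R [ 9 ≔ R 9 + R 14 ]) [ 9 ≔ R 9 + R 14 ∸ R 2 ]) [ 9 ≔ v ]) [ 10 ≔ R 10 ∸ R 3 ])
      [ 6 ≔ R 6 + R 2 ]) [ 1 ≔ R 1 ∸ R 2 ]

    v≡ : v ≡ partialLoad σ (toℕ j) b + p j
    v≡ rewrite r₉ | r₁₄ | r₂ = cong (_∸ 1) (ℕ.+-suc (partialLoad σ (toℕ j) b) (p j))

    -- Addresses and values become variables, so that matching on `refl` replaces them throughout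
    -- the memory.
    result : ∀ a v a′ v′ → a ≡ n * m + toℕ b → v ≡ partialLoad σ (toℕ j) b + p j →
      a′ ≡ n * m + m + toℕ j → v′ ≡ toℕ b →
      Planned (suc (toℕ j)) d ⟨ 7 , R′ , (M [ a ≔ v ]) [ a′ ≔ v′ ] ⟩
    result _ _ _ _ refl refl refl refl = planned
      (r₀ , cong₂ _∸_ r₁ r₂ , r₂ , r₃ , +-suc′ (n * m + m) (toℕ j) r₆ r₂)
      -- The scan moved the input pointer by `m`, to the start of the next row.
      (trans r₇ (ℕ.+-comm (toℕ j * m) m))
      (assign-input {M} {σ} j b input loads outs)
      (assign-loads {M} {σ} j b input loads outs)
      (assign-outputs {M} {σ} j b input loads outs)
      (extend S b-fin (λ i → least i (Fin.toℕ<n i)))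

    planned-next : Planned (suc (toℕ j)) d ⟨ 7 , R′ , (M [ R 10 ≔ v ]) [ R 6 ≔ R 10 ∸ R 3 ] ⟩
    planned-next = result (R 10) v (R 6) (R 10 ∸ R 3) r₁₀ v≡ r₆
      (trans (cong₂ _∸_ r₁₀ r₃) (ℕ.m+n∸m≡n (n * m) (toℕ b)))

  -- The budget is 4 for set-up, 15 per machine, and 10 for leaving the scan and assigning the job.
  plan-job : ∀ (j : Fin n) {d s} → Planned (toℕ j) (suc d) s →
    Run listScheduling s (4 + (m * 15 + 10)) (Planned (suc (toℕ j)) d)
  plan-job j {d} (planned {R} {M} {σ} F@(r₀ , r₁ , _ , r₃ , _) r₇ input loads outs S) =
    step-nonzero refl (λ r₁≡0 → contradiction (trans (sym r₁) r₁≡0) λ ())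
      (step refl (step refl (step refl
        (iterate (Scanned (partialLoad σ (toℕ j)) j (suc d) (n * m + m + toℕ j) M)
           (scan-machine input loads) 0 m refl
           (scanned F r₀ (trans r₇ (sym (ℕ.+-identityʳ (toℕ j * m))))
             (trans r₃ (sym (ℕ.+-identityʳ (n * m)))) (none refl λ _ ()))
         then assign-job j input loads outs S))))

  -- Invariant of the loop at instruction 2, which replaces the missing multiplication instruction
  -- by adding `m` once per job.
  data Sized (k d : ℕ) : State → Set where
    sized : ∀ {R} → R 0 ≡ m → R 1 ≡ n → R 2 ≡ 1 → R 3 ≡ k * m → R 4 ≡ d → R 7 ≡ 0 →
      Sized k d ⟨ 2 , R , inputMemory I ⟩

  count-row : ∀ (j : Fin n) {d s} → Sized (toℕ j) (suc d) s →
    Run listScheduling s 4 (Sized (suc (toℕ j)) d)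
  count-row j (sized r₀ r₁ r₂ r₃ r₄ r₇) =
    step-nonzero refl (λ r₄≡0 → contradiction (trans (sym r₄) r₄≡0) λ ())
      (step refl (step refl (step refl (stop (sized r₀ r₁ r₂
        (trans (cong₂ _+_ r₃ r₀) (ℕ.+-comm (toℕ j * m) m)) (cong₂ _∸_ r₄ r₂) r₇)))))

  start : ∀ {s} → Sized n 0 s → Run listScheduling s 2 (Planned 0 n)
  start (sized r₀ r₁ r₂ r₃ r₄ r₇) = step-zero refl r₄ (step refl (stop
    -- A placeholder: any assignment may start the job loop, since no job counts as placed yet.
    (planned {σ = proj₁ ∘ coverage}
      (r₀ , r₁ , r₂ , r₃ , trans (cong₂ _+_ r₃ r₀) (sym (ℕ.+-identityʳ (n * m + m))))
      r₇ inputMemory-input (λ i → inputMemory-beyond (toℕ i)) (λ _ ()) (emptySchedule _))))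

  Final : State → Set
  Final s = ∃[ σ ] (Outputs s σ × PartialSchedule n σ)

  -- Instruction 35 is the last one, so the counter leaves the program; it sets register 0 to
  -- `n * m + m`, where the output begins.
  conclude : ∀ {s} → Planned n 0 s →
    Run listScheduling s 2 (λ s′ → fetch listScheduling (pc s′) ≡ nothing × Final s′)
  conclude (planned {R} {M} {σ} (r₀ , r₁ , r₂ , r₃ , r₆) r₇ input loads outs S) =
    step-zero refl r₁ (step refl (stop (refl , σ ,
      (λ j → trans (cong (λ a → M (a + toℕ j)) (cong₂ _+_ r₃ r₀)) (outs j (Fin.toℕ<n j))) , S)))

  steps : ℕ
  steps = 2 + (n * 4 + (2 + (n * (4 + (m * 15 + 10)) + 2)))

  run : ∃[ t ] ∃[ s ] ((listScheduling ⊢ initial I ⇓[ t ] s) × t ≤ steps × Final s)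
  run = halts (step refl (step refl
    (iterate Sized count-row 0 n refl (sized refl refl refl refl refl refl)
     then λ counted → start counted
     then λ begun → iterate Planned plan-job 0 n refl begun
     then conclude)))

-- The step bound and the theorem

-- The constant 39 is the value of the left side at `m = n = 1`. In terms of `m-1` and `n-1`, the
-- difference of the two sides is a polynomial with nonnegative coefficients, `slack`.
steps-bound : ∀ m n .{{_ : NonZero m}} .{{_ : NonZero n}} →
  2 + (n * 4 + (2 + (n * (4 + (m * 15 + 10)) + 2))) ≤ 39 * (m * m * n)
steps-bound m@(suc m-1) n@(suc n-1) = begin
  2 + (n * 4 + (2 + (n * (4 + (m * 15 + 10)) + 2)))
    ≤⟨ ℕ.m≤m+n _ _ ⟩
  2 + (n * 4 + (2 + (n * (4 + (m * 15 + 10)) + 2))) + slack m-1 n-1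
    ≡⟨ identity m-1 n-1 ⟩
  39 * (m * m * n) ∎
  where
  open ℕ.≤-Reasoning
  slack : ℕ → ℕ → ℕ
  slack a b = 39 * (a * a * b) + 39 * (a * a) + 63 * (a * b) + 63 * a + 6 * b
  identity : ∀ a b →
    2 + (suc b * 4 + (2 + (suc b * (4 + (suc a * 15 + 10)) + 2))) +
      (39 * (a * a * b) + 39 * (a * a) + 63 * (a * b) + 63 * a + 6 * b)
      ≡ 39 * (suc a * suc a * suc b)
  identity = solve-∀

theorem2p10 : ∃[ P ] ∃[ c ] ((m n : ℕ) .{{_ : NonZero m}} .{{_ : NonZero n}} (I : Instance m n) →
    ∃[ t ] ∃[ s ] ∃[ σ ]
    (P ⊢ initial I ⇓[ t ] s)
    × (t ≤ c * (m * m * n))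
    × Outputs s σ
    × Feasible I σ
    × (ℕ⇒ℚ (makespan I σ) ℚ.≤ ℕ⇒ℚ (pmax I) ℚ.+ (Lopt I ÷ φ I) {{φ-nonZero I}})
    × (ℕ⇒ℚ (pmax I) ℚ.+ (Lopt I ÷ φ I) {{φ-nonZero I}}
    ≡ ℕ⇒ℚ (pmax I) ℚ.+ (ℕ⇒ℚ (totalTime I) ÷ (ℕ⇒ℚ m ℚ.* φ I)) {{mφ-nonZero I}}))
theorem2p10 = listScheduling , 39 , λ m n I →
  let open Greedy I
      open Bound I
      t , s , halts-in-t , t≤steps , σ , outputs , S = Simulation.run I
  in t , s , σ , halts-in-t , ℕ.≤-trans t≤steps (steps-bound m n) , outputs ,
     complete-feasible S , makespan≤ (makespan I σ) (complete-makespan S) ,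
     cong (ℕ⇒ℚ (pmax I) ℚ.+_) bound≡
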